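{- Let $p\ge 1$ be a constant integer. There is no $p$-pass streaming algorithm with a single output pass which uses $o(N^{1/2})$ bits of space on inputs of length $N$ and which solves Sliding-Min for all window sizes $K$ when the maximum element value is $R=K$.
   Context: Problem. The input is an array $A_0,\dots,A_{N-1}$ of integers in $[0,R]$ together with a window size $K\le N$. Sliding-Min asks for the minimum of $A_i,\dots,A_{i+K-1}$ for every $i\in\{0,\dots,N-K\}$. $p$-pass streaming model. Algorithms are exact and deterministic: they must give the correct output on every input. The algorithm knows $N,K,R$ in advance. The input is accessed only through $p$ sequential left-to-right scans (input passes). The $N-K+1$ answers are written to a write-only output stream, each exactly once. A single output pass means that, over the whole execution, the answers are written in the order of increasing window index $i=0,1,\dots,N-K$. Output need not be synchronized with the input position: at any time the algorithm may write any number of answers. Space is the maximum number of bits of working memory kept while scanning the input (so with space $M$ there are at most $2^M$ memory states); input and output streams are not counted. Space $o(N^{1/2})$ means that the maximum of the space used over all window sizes $K$, as a function of $N$, is $o(N^{1/2})$. -}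

module Defs where

open import Data.Nat using (ℕ; zero; suc; _*_; _∸_; _^_; _≤_)
open import Data.Fin using (Fin; zero; suc; toℕ)
open import Data.List using (List; []; _++_; map; take; drop; upTo; applyUpTo)
open import Data.List.Extrema.Nat using (min; max)
open import Data.Product using (_×_; _,_; proj₂; Σ-syntax; ∃-syntax)
open import Data.Vec.Functional using (Vector; toList)
open import Function using (_∘_)
open import Relation.Binary.PropositionalEquality using (_≡_)

-- Entries are integers in [0,R].
Input : ℕ → ℕ → Set
Input N R = Vector (Fin (suc R)) N

-- The element at position j of pass r is processed in one step, which updates
-- the memory and writes any number of values to the output stream. Steps are
-- arbitrary functions and may depend on r and j without charge; since storing
-- (r , j) takes only O(log N) bits for constant p, this does not affect o(√N)
-- space bounds.
record Algorithm (p N R M : ℕ) : Set where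
  field
    init : Fin (2 ^ M)
    step : Fin p → Fin N → Fin (2 ^ M) → Fin (suc R) → Fin (2 ^ M) × List ℕ

-- Threads the state through f 0, f 1, …, f (n − 1), concatenating the outputs.
execute : {S O : Set} (n : ℕ) → (Fin n → S → S × List O) → S → S × List O
execute zero    f s = s , []
execute (suc n) f s =
  let s₁ , out₁ = f zero s
      s₂ , out₂ = execute n (f ∘ suc) s₁
  in  s₂ , out₁ ++ out₂

module _ {p N R M : ℕ} (alg : Algorithm p N R M) where
  open Algorithm alg

  scan : Input N R → Fin p → Fin (2 ^ M) → Fin (2 ^ M) × List ℕ
  scan A r = execute N (λ j s → step r j s (A j))

  output : Input N R → List ℕ
  output A = proj₂ (execute p (scan A) init)

-- The first argument of min is the value on an empty list; as all entries are
-- at most R, it has no influence on a nonempty window.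
windowMin : {N R : ℕ} → ℕ → Input N R → ℕ → ℕ
windowMin {R = R} K A i = min R (take K (drop i (map toℕ (toList A))))

slidingMin : {N R : ℕ} → ℕ → Input N R → List ℕ
slidingMin {N} K A = map (windowMin K A) (upTo (suc (N ∸ K)))

-- Equality of lists expresses the single output pass: over the whole execution,
-- every answer is written exactly once, in order of increasing window index.
SolvesInSingleOutputPass : {p N R M : ℕ} → ℕ → Algorithm p N R M → Set
SolvesInSingleOutputPass {N = N} {R = R} K alg =
  (A : Input N R) → output alg A ≡ slidingMin K A

-- The maximum of space N K over the window sizes K = 1, …, N.
maxSpace : (ℕ → ℕ → ℕ) → ℕ → ℕ
maxSpace space N = max 0 (map (space N) (applyUpTo suc N))

-- f(N) = o(N^{1/2}): for every c, eventually f(N) ≤ √N / c, squared to stay in ℕ.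
IsLittleO√ : (ℕ → ℕ) → Set
IsLittleO√ f = ∀ c → ∃[ N₀ ] (∀ N → N₀ ≤ N → (c * f N) ^ 2 ≤ N)

-- For each length N and window size K, an algorithm that may be chosen with
-- full knowledge of N and K, on inputs with R = K.
SolvesAllWindowSizes : ℕ → (ℕ → ℕ → ℕ) → Set
SolvesAllWindowSizes p space =
  ∀ N K → 1 ≤ K → K ≤ N →
  Σ[ alg ∈ Algorithm p N K (space N K) ] SolvesInSingleOutputPass K alg

{-# OPTIONS --safe #-}
module Submission where

-- The input consists of p groups of H gadgets. A gadget holds k = K - 1 cells
-- carrying arbitrary bits x, followed by k cells that are all K or all 0,
-- depending on a switch bit y. The windows starting at the k bit cells reveal
-- the bits if the switch is on, and all have minimum 0 if it is off.
--
-- As the answers come in order, some pass r writes all answers of group r.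
-- Fix x. As 2^H exceeds the number of states and output lengths at the start
-- of pass r, two settings y agreeing off group r give the same state and
-- output length there. They stay indistinguishable in pass r until the first
-- switch in which they differ, so the answers of that gadget (r , b) are not
-- written before its switch is read, even for the setting that turns it on.
-- Hence the memory after the bit cells has to hold their k bits: as 2^k exceeds
-- the number of choices of y, gadgets and states, two x that differ only in
-- the bits of that gadget lead to the same state and hence the same answers.
-- With space M ≤ h, the choice H = 5 h, k = 12 p h and N = 120 p² h² works.

open import Data.Empty using (⊥)
open import Data.Fin using (Fin; zero; suc; toℕ; inject₁; fromℕ; join; combine; remQuot; splitAt; fromℕ<; funToFin; finToFun; punchOut)
import Data.Fin.Properties as Fin
open import Data.List using (List; []; _∷_; _++_; length; take; drop; tabulate; applyUpTo)
open import Data.List.Extrema.Nat using (min≤v⁺; v≤min⁺; v≤max⁺)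
open import Data.List.Properties using (∷-injectiveˡ; ∷-injectiveʳ; ++-assoc; ++-identityʳ; length-++; length-applyUpTo; map-upTo; map-tabulate)
open import Data.List.Relation.Unary.All using (All; []; _∷_)
open import Data.List.Relation.Unary.Any using (Any; here; there)
import Data.List.Relation.Unary.Any.Properties as Any
open import Data.Nat using (ℕ; zero; suc; _+_; _*_; _∸_; _^_; _≤_; _<_; z≤n; s≤s; NonZero; >-nonZero; >-nonZero⁻¹)
open import Data.Nat.Properties
open import Data.Nat.Solver using (module +-*-Solver)
open import Data.Product using (_×_; _,_; proj₁; proj₂; ∃-syntax; ∃₂)
open import Data.Sum using (_⊎_; [_,_]′; inj₁; inj₂)
open import Data.Vec.Functional using (removeAt)
open import Function using (_∘_; it)
open import Relation.Binary.PropositionalEquality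
open import Relation.Nullary using (¬_; yes; no; contradiction)
open import Defs
open +-*-Solver using (solve; _:=_; _:+_; _:*_; con)

-- Cutting an execution in two

module _ {S O : Set} where

  before : (n : ℕ) → (Fin n → S → S × List O) → ℕ → S → S × List O
  before n       f zero    s = s , []
  before zero    f (suc t) s = s , []
  before (suc n) f (suc t) s =
    let s₁ , out₁ = f zero s
        s₂ , out₂ = before n (f ∘ suc) t s₁
    in  s₂ , out₁ ++ out₂

  after : (n : ℕ) → (Fin n → S → S × List O) → ℕ → S → S × List O
  after n       f zero    s = execute n f s
  after zero    f (suc t) s = s , []
  after (suc n) f (suc t) s = after n (f ∘ suc) t s

  execute-split : ∀ n (f : Fin n → S → S × List O) t s →
    let s₁ , out₁ = before n f t s
        s₂ , out₂ = after n f t s₁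
    in  execute n f s ≡ (s₂ , out₁ ++ out₂)
  execute-split n       f zero    s = refl
  execute-split zero    f (suc t) s = refl
  execute-split (suc n) f (suc t) s
    rewrite execute-split n (f ∘ suc) t (proj₁ (f zero s)) =
    cong₂ _,_ refl (sym (++-assoc (proj₂ (f zero s)) _ _))

  before-suc : ∀ n (f : Fin n → S → S × List O) i s →
    let s₁ , out₁ = before n f (toℕ i) s
        s₂ , out₂ = f i s₁
    in  before n f (suc (toℕ i)) s ≡ (s₂ , out₁ ++ out₂)
  before-suc (suc n) f zero    s = cong₂ _,_ refl (++-identityʳ (proj₂ (f zero s)))
  before-suc (suc n) f (suc i) s
    rewrite before-suc n (f ∘ suc) i (proj₁ (f zero s)) =
    cong₂ _,_ refl (sym (++-assoc (proj₂ (f zero s)) _ _))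

  before-all : ∀ n (f : Fin n → S → S × List O) s → before n f n s ≡ execute n f s
  before-all zero    f s = refl
  before-all (suc n) f s rewrite before-all n (f ∘ suc) (proj₁ (f zero s)) = refl

  -- Expresses that an algorithm cannot react to input it has not read yet.
  before-cong : ∀ n {f g : Fin n → S → S × List O} t s →
    (∀ i → toℕ i < t → f i ≗ g i) → before n f t s ≡ before n g t s
  before-cong n       zero    s f≗g = refl
  before-cong zero    (suc t) s f≗g = refl
  before-cong (suc n) {f} {g} (suc t) s f≗g
    rewrite f≗g zero (s≤s z≤n) s
          | before-cong n {f ∘ suc} {g ∘ suc} t (proj₁ (g zero s)) (λ i → f≗g (suc i) ∘ s≤s) = refl

  -- Expresses that the past of a pass acts on its future through the memory state alone.
  after-cong : ∀ n {f g : Fin n → S → S × List O} t s →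
    (∀ i → t ≤ toℕ i → f i ≗ g i) → after n f t s ≡ after n g t s
  after-cong zero    zero    s f≗g = refl
  after-cong (suc n) {f} {g} zero s f≗g
    rewrite f≗g zero z≤n s
          | after-cong n {f ∘ suc} {g ∘ suc} zero (proj₁ (g zero s)) (λ i _ → f≗g (suc i) z≤n) = refl
  after-cong zero    (suc t) s f≗g = refl
  after-cong (suc n) (suc t) s f≗g = after-cong n t s (λ i → f≗g (suc i) ∘ s≤s)

-- Window minima and the order of the answers

module _ {P : ℕ → Set} where

  all-window : ∀ {n} (f : Fin n → ℕ) K i →
    (∀ j → i ≤ toℕ j → toℕ j < i + K → P (f j)) → All P (take K (drop i (tabulate f)))
  all-window         f zero    i       h = []
  all-window {zero}  f (suc K) zero    h = []
  all-window {zero}  f (suc K) (suc i) h = []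
  all-window {suc n} f (suc K) zero    h =
    h zero z≤n (s≤s z≤n) ∷ all-window (f ∘ suc) K zero (λ j _ j<K → h (suc j) z≤n (s≤s j<K))
  all-window {suc n} f (suc K) (suc i) h =
    all-window (f ∘ suc) (suc K) i (λ j i≤j j<i+K → h (suc j) (s≤s i≤j) (s≤s j<i+K))

  any-window : ∀ {n} (f : Fin n → ℕ) K i j →
    i ≤ toℕ j → toℕ j < i + K → P (f j) → Any P (take K (drop i (tabulate f)))
  any-window f (suc K) zero    zero    i≤j j<i+K p = here p
  any-window f (suc K) zero    (suc j) i≤j (s≤s j<K) p = there (any-window (f ∘ suc) K zero j z≤n j<K p)
  any-window f K       (suc i) (suc j) (s≤s i≤j) (s≤s j<i+K) p = any-window (f ∘ suc) K i j i≤j j<i+K p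

module _ {N R : ℕ} (K : ℕ) (A : Input N R) where

  -- `v ≤ R` accounts for the default `R`, over which `min` ranges along with the entries of the
  -- window.
  ≤windowMin : ∀ i v → v ≤ R →
    (∀ j → i ≤ toℕ j → toℕ j < i + K → v ≤ toℕ (A j)) → v ≤ windowMin K A i
  ≤windowMin i v v≤R h rewrite map-tabulate A toℕ = v≤min⁺ v≤R (all-window (toℕ ∘ A) K i h)

  windowMin≤ : ∀ i v j → i ≤ toℕ j → toℕ j < i + K → toℕ (A j) ≤ v → windowMin K A i ≤ v
  windowMin≤ i v j i≤j j<i+K h rewrite map-tabulate A toℕ =
    min≤v⁺ R _ (inj₂ (any-window (toℕ ∘ A) K i j i≤j j<i+K h))

  -- For `K = suc k` the number `suc N ∸ K` of windows reduces to `N ∸ k`, the form it has later.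
  slidingMin≡applyUpTo : K ≤ N → slidingMin K A ≡ applyUpTo (windowMin K A) (suc N ∸ K)
  slidingMin≡applyUpTo K≤N rewrite +-∸-assoc 1 K≤N = map-upTo (windowMin K A) (suc (N ∸ K))

-- This is where the single output pass enters: the place of an answer in the output determines its
-- window, whatever is written around it.
common-segment : ∀ (u v : ℕ → ℕ) m n pre pre′ seg {post post′ i} →
  pre ++ seg ++ post ≡ applyUpTo u m → pre′ ++ seg ++ post′ ≡ applyUpTo v n →
  length pre ≡ length pre′ → length pre ≤ i → i < length pre + length seg → u i ≡ v i
common-segment u v (suc m) (suc n) [] [] (x ∷ seg) {i = zero} eq eq′ l _ _ =
  trans (sym (∷-injectiveˡ eq)) (∷-injectiveˡ eq′)
common-segment u v (suc m) (suc n) [] [] (x ∷ seg) {i = suc i} eq eq′ l _ (s≤s i<) =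
  common-segment (u ∘ suc) (v ∘ suc) m n [] [] seg
    (∷-injectiveʳ eq) (∷-injectiveʳ eq′) refl z≤n i<
common-segment u v (suc m) (suc n) (_ ∷ pre) (_ ∷ pre′) seg {i = suc i} eq eq′ l (s≤s ≤i) (s≤s i<) =
  common-segment (u ∘ suc) (v ∘ suc) m n pre pre′ seg
    (∷-injectiveʳ eq) (∷-injectiveʳ eq′) (suc-injective l) ≤i i<

-- The last r with count r ≤ a r works, as e (suc r) ≤ a (suc r) < count (suc r)
-- otherwise.
crossing : ∀ (count a e : ℕ → ℕ) → count 0 ≤ a 0 → (∀ r → e r ≤ a r) →
  ∀ n → e (suc n) ≤ count (suc n) →
  ∃[ r ] count (toℕ {suc n} r) ≤ a (toℕ r) × e (suc (toℕ r)) ≤ count (suc (toℕ r))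
crossing count a e c₀ e≤a zero    end = zero , c₀ , end
crossing count a e c₀ e≤a (suc n) end with count (suc n) ≤? a (suc n)
... | yes c≤a = fromℕ (suc n) , subst Crosses (sym (Fin.toℕ-fromℕ (suc n))) (c≤a , end)
  where
  Crosses : ℕ → Set
  Crosses r = count r ≤ a r × e (suc r) ≤ count (suc r)
... | no  c≰a
  with r , h ← crossing count a e c₀ e≤a n (≤-trans (e≤a (suc n)) (<⇒≤ (≰⇒> c≰a)))
  = inject₁ r , subst Crosses (sym (Fin.toℕ-inject₁ r)) h
  where
  Crosses : ℕ → Set
  Crosses r = count r ≤ a r × e (suc r) ≤ count (suc r)

-- Finite functions and a pigeonhole principle

first-difference : ∀ {n m} (f g : Fin n → Fin m) → ¬ (f ≗ g) →
  ∃[ i ] f i ≢ g i × (∀ j → toℕ j < toℕ i → f j ≡ g j)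
first-difference f g f≢g
  with i , fi≢gi , agree ← Fin.¬∀⟶∃¬-smallest _ (λ i → f i ≡ g i) (λ i → f i Fin.≟ g i) f≢g
  = i , fi≢gi , λ j j<i →
      -- Minimality of `i` is stated for injected elements of `Fin (toℕ i)`, so `j` is written as
      -- one.
      let inject-j = Fin.toℕ-injective (trans (Fin.toℕ-inject (fromℕ< j<i)) (Fin.toℕ-fromℕ< j<i))
      in  subst (λ j → f j ≡ g j) inject-j (agree (fromℕ< j<i))

distinct-bits : ∀ (a b : Fin 2) → a ≢ b → (a ≡ zero × b ≡ suc zero) ⊎ (b ≡ zero × a ≡ suc zero)
distinct-bits zero       zero       a≢b = contradiction refl a≢b
distinct-bits zero       (suc zero) a≢b = inj₁ (refl , refl)
distinct-bits (suc zero) zero       a≢b = inj₂ (refl , refl)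
distinct-bits (suc zero) (suc zero) a≢b = contradiction refl a≢b

-- Coding functions as numbers below `m ^ n` turns pointwise equality into equality of codes without
-- function extensionality.
finToFun-injective : ∀ {m n} (a b : Fin (m ^ n)) → finToFun {m} {n} a ≗ finToFun b → a ≡ b
finToFun-injective {m} {n} a b eq = begin
  a                             ≡⟨ Fin.funToFin-finToFin {n} {m} a ⟨
  funToFin (finToFun {m} {n} a) ≡⟨ funToFin-cong eq ⟩
  funToFin (finToFun {m} {n} b) ≡⟨ Fin.funToFin-finToFin {n} {m} b ⟩
  b                             ∎
  where
  open ≡-Reasoning
  funToFin-cong : ∀ {k} {f g : Fin k → Fin m} → f ≗ g → funToFin f ≡ funToFin g
  funToFin-cong {zero}  f≗g = refl
  funToFin-cong {suc k} f≗g = cong₂ combine (f≗g zero) (funToFin-cong (f≗g ∘ suc))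

-- Every point of a cube picks one of its lines, by direction i; as there are
-- n d^(n-1) lines, some line is picked twice with the same colour.
cube-pigeonhole : ∀ n d c → n * c < d → (colour : (Fin n → Fin d) → Fin n × Fin c) →
  ∃₂ λ x x′ → let i = proj₁ (colour x) in
    colour x ≡ colour x′ × x i ≢ x′ i × (∀ j → j ≢ i → x j ≡ x′ j)
-- Without coordinates there is no direction for the colour to name.
cube-pigeonhole zero    d c _ colour with () ← proj₁ (colour λ ())
cube-pigeonhole (suc n) d c nc<d colour = x , x′ , cong₂ _,_ i≡i′ c≡c′ , differ , agree
  where
  instance
    d≢0 : NonZero d
    d≢0 = >-nonZero (≤-<-trans z≤n nc<d)
    dⁿ≢0 : NonZero (d ^ n)
    dⁿ≢0 = m^n≢0 d n
  bound : suc n * c * d ^ n < d ^ suc n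
  bound = *-monoˡ-< (d ^ n) nc<d
  -- The code consists of the direction, the colour and the coordinates off the direction.
  line : Fin (d ^ suc n) → Fin (suc n * c * d ^ n)
  line a = let x = finToFun a in
    combine (combine (proj₁ (colour x)) (proj₂ (colour x))) (funToFin (removeAt x (proj₁ (colour x))))
  collision = Fin.pigeonhole bound line
  a  = proj₁ collision
  b  = proj₁ (proj₂ collision)
  x x′ : Fin (suc n) → Fin d
  x  = finToFun a
  x′ = finToFun b
  i i′ : Fin (suc n)
  i  = proj₁ (colour x)
  i′ = proj₁ (colour x′)
  eqs = Fin.combine-injective (combine i (proj₂ (colour x))) (funToFin (removeAt x i)) _ _ (proj₂ (proj₂ (proj₂ collision)))
  i≡i′ = proj₁ (Fin.combine-injective i (proj₂ (colour x)) i′ (proj₂ (colour x′)) (proj₁ eqs))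
  c≡c′ = proj₂ (Fin.combine-injective i (proj₂ (colour x)) i′ (proj₂ (colour x′)) (proj₁ eqs))
  removed : removeAt x i ≗ removeAt x′ i
  removed j = begin
    removeAt x i j                        ≡⟨ Fin.finToFun-funToFin (removeAt x i) j ⟨
    finToFun (funToFin (removeAt x i)) j  ≡⟨ cong (λ z → finToFun {d} {n} z j) (proj₂ eqs) ⟩
    finToFun (funToFin (removeAt x′ i′)) j ≡⟨ Fin.finToFun-funToFin (removeAt x′ i′) j ⟩
    removeAt x′ i′ j                      ≡⟨ cong (λ i → removeAt x′ i j) i≡i′ ⟨
    removeAt x′ i j                       ∎
    where open ≡-Reasoning
  agree : ∀ j → j ≢ i → x j ≡ x′ j
  agree j j≢i = subst (λ j → x j ≡ x′ j) (Fin.punchIn-punchOut i≢j) (removed (punchOut i≢j))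
    where
    i≢j : i ≢ j
    i≢j = j≢i ∘ sym
  -- The points share a line, so equality in its direction would make them, and hence `a` and `b`,
  -- equal.
  differ : x i ≢ x′ i
  differ xi≡x′i = Fin.<⇒≢ (proj₁ (proj₂ (proj₂ collision))) (finToFun-injective {d} {suc n} a b same)
    where
    same : x ≗ x′
    same j with j Fin.≟ i
    ... | yes refl = xi≡x′i
    ... | no  j≢i  = agree j j≢i

-- The hard inputs and their window minima

module Gadgets (p H k : ℕ) where

  w N K : ℕ
  w = k + k
  N = p * H * w
  K = suc k

  origin : Fin (p * H) → ℕ
  origin g = w * toℕ g

  -- A set bit i has the value i + 1, less than all values to its right in a
  -- gadget that is switched on, so it is seen in the window that starts at it.
  cell : (Fin k → Fin 2) → Fin 2 → Fin k ⊎ Fin k → Fin (suc K)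
  cell bits c (inj₁ i) with bits i
  ... | zero     = fromℕ K
  ... | suc zero = inject₁ (suc i)
  cell bits zero       (inj₂ _) = zero
  cell bits (suc zero) (inj₂ _) = fromℕ K

  -- `x` has one coordinate per gadget and `y` one per group, as the pigeonhole arguments vary all
  -- bits of one gadget and all switches of one group.
  bits : (Fin (p * H) → Fin (2 ^ k)) → Fin (p * H) → Fin k → Fin 2
  bits x g = finToFun (x g)

  switch : (Fin p → Fin (2 ^ H)) → Fin p × Fin H → Fin 2
  switch y (r , b) = finToFun (y r) b

  content : (Fin (p * H) → Fin (2 ^ k)) → (Fin p → Fin (2 ^ H)) → Fin (p * H) × Fin w → Fin (suc K)
  content x y (g , o) = cell (bits x g) (switch y (remQuot H g)) (splitAt k o)

  input : (Fin (p * H) → Fin (2 ^ k)) → (Fin p → Fin (2 ^ H)) → Input N K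
  input x y j = content x y (remQuot w j)

  -- A view by group, gadget and half of the gadget, which replaces division by `w` and `H` in case
  -- distinctions.
  data Position : Fin N → Set where
    at : ∀ (r : Fin p) (b : Fin H) o → Position (combine (combine r b) (join k k o))

  position : ∀ j → Position j
  position j
    with g , o , refl ← Fin.combine-surjective {p * H} {w} j
    with r , b , refl ← Fin.combine-surjective {p} {H} g
    = subst (λ o → Position (combine (combine r b) o)) (Fin.join-splitAt k k o) (at r b (splitAt k o))

  toℕ-at : ∀ (g : Fin (p * H)) o → toℕ (combine g (join k k o)) ≡ origin g + toℕ (join k k o)
  toℕ-at g o = Fin.toℕ-combine g (join k k o)

  toℕ-at₁ : ∀ (g : Fin (p * H)) i → toℕ (combine g (join k k (inj₁ i))) ≡ origin g + toℕ i
  toℕ-at₁ g i = trans (toℕ-at g (inj₁ i)) (cong (origin g +_) (Fin.toℕ-↑ˡ i k))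

  toℕ-at₂ : ∀ (g : Fin (p * H)) i → toℕ (combine g (join k k (inj₂ i))) ≡ origin g + (k + toℕ i)
  toℕ-at₂ g i = trans (toℕ-at g (inj₂ i)) (cong (origin g +_) (Fin.toℕ-↑ʳ k i))

  input-at : ∀ x y r b o → input x y (combine (combine r b) (join k k o)) ≡
    cell (bits x (combine r b)) (switch y (r , b)) o
  input-at x y r b o = trans
    (cong (content x y) (Fin.remQuot-combine (combine r b) (join k k o)))
    (cong₂ (cell (bits x (combine r b)))
      (cong (switch y) (Fin.remQuot-combine r b))
      (Fin.splitAt-join k k o))

  cell-set : ∀ bits c i → bits i ≡ suc zero → toℕ (cell bits c (inj₁ i)) ≡ suc (toℕ i)
  cell-set bits c i eq rewrite eq = Fin.toℕ-inject₁ (suc i)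

  origin+w : ∀ g → origin g + w ≡ w * suc (toℕ g)
  origin+w g = trans (+-comm (origin g) w) (sym (*-suc w (toℕ g)))

  origin-cancel-< : ∀ g g′ → origin g < origin g′ + w → toℕ g ≤ toℕ g′
  origin-cancel-< g g′ lt =
    ≤-pred (*-cancelˡ-< w (toℕ g) (suc (toℕ g′)) (subst (origin g <_) (origin+w g′) lt))

  group-origin≤ : ∀ (r : Fin p) (b : Fin H) → w * (H * toℕ r) ≤ origin (combine r b)
  group-origin≤ r b rewrite Fin.toℕ-combine r b = *-monoʳ-≤ w (m≤m+n (H * toℕ r) (toℕ b))

  ≤group-end : ∀ (r : Fin p) (b : Fin H) → origin (combine r b) + w ≤ w * (H * suc (toℕ r))
  ≤group-end r b = begin
    origin (combine r b) + w       ≡⟨ origin+w (combine r b) ⟩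
    w * suc (toℕ (combine r b))    ≡⟨ cong (λ g → w * suc g) (Fin.toℕ-combine r b) ⟩
    w * suc (H * toℕ r + toℕ b)    ≤⟨ *-monoʳ-≤ w (+-monoʳ-< (H * toℕ r) (Fin.toℕ<n b)) ⟩
    w * (H * toℕ r + H)            ≡⟨ cong (w *_) (trans (+-comm (H * toℕ r) H) (sym (*-suc H (toℕ r)))) ⟩
    w * (H * suc (toℕ r))          ∎
    where open ≤-Reasoning

  end≡N : w * (H * p) ≡ N
  end≡N = trans (*-comm w (H * p)) (cong (_* w) (*-comm H p))

  origin≤N : ∀ g → origin g ≤ N
  origin≤N g = subst (origin g ≤_) (*-comm w (p * H)) (*-monoʳ-≤ w (<⇒≤ (Fin.toℕ<n g)))

  -- A window that starts at bit cell `i` ends at offset `i + k < w`, inside the same gadget.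
  window-gadget : ∀ (g g′ : Fin (p * H)) o i → i < k →
    origin g + i ≤ toℕ (combine g′ (join k k o)) → toℕ (combine g′ (join k k o)) < origin g + i + K → g ≡ g′
  window-gadget g g′ o i i<k lo hi = Fin.toℕ-injective (≤-antisym
    (origin-cancel-< g g′ (begin-strict
      origin g                        ≤⟨ m≤m+n (origin g) i ⟩
      origin g + i                    ≤⟨ lo ⟩
      toℕ (combine g′ (join k k o))   ≡⟨ toℕ-at g′ o ⟩
      origin g′ + toℕ (join k k o)    <⟨ +-monoʳ-< (origin g′) (Fin.toℕ<n (join k k o)) ⟩
      origin g′ + w                   ∎))
    (origin-cancel-< g′ g (begin-strict
      origin g′                       ≤⟨ m≤m+n (origin g′) _ ⟩
      origin g′ + toℕ (join k k o)    ≡⟨ toℕ-at g′ o ⟨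
      toℕ (combine g′ (join k k o))   <⟨ hi ⟩
      origin g + i + K                ≡⟨ +-assoc (origin g) i K ⟩
      origin g + (i + K)              ≡⟨ cong (origin g +_) (+-suc i k) ⟩
      origin g + (suc i + k)          ≤⟨ +-monoʳ-≤ (origin g) (+-monoˡ-≤ k i<k) ⟩
      origin g + w                    ∎)))
    where open ≤-Reasoning

  module _ (x : Fin (p * H) → Fin (2 ^ k)) (y : Fin p → Fin (2 ^ H)) (r : Fin p) (b : Fin H) where

    private
      g : Fin (p * H)
      g = combine r b

    windowMin-set : ∀ i → bits x g i ≡ suc zero →
      windowMin K (input x y) (origin g + toℕ i) ≤ suc (toℕ i)
    windowMin-set i set = windowMin≤ K (input x y) _ _ (combine g (join k k (inj₁ i)))
      (≤-reflexive (sym (toℕ-at₁ g i)))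
      (subst (_< origin g + toℕ i + K) (sym (toℕ-at₁ g i)) (m<m+n _ (s≤s z≤n)))
      (≤-reflexive (trans (cong toℕ (input-at x y r b (inj₁ i))) (cell-set (bits x g) (switch y (r , b)) i set)))

    -- The window at the origin has length `k + 1` and just reaches the first switch cell, at offset
    -- `k`.
    windowMin-zero : 0 < k → switch y (r , b) ≡ zero → windowMin K (input x y) (origin g) ≤ 0
    windowMin-zero 0<k clear = windowMin≤ K (input x y) _ _ (combine g (join k k (inj₂ i)))
      (subst (origin g ≤_) (sym toℕ-switch) (m≤m+n (origin g) k))
      (subst (_< origin g + K) (sym toℕ-switch) (+-monoʳ-< (origin g) (n<1+n k)))
      (≤-reflexive (trans (cong toℕ (input-at x y r b (inj₂ i)))
                          (cong (λ c → toℕ (cell (bits x g) c (inj₂ i))) clear)))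
      where
      i : Fin k
      i = fromℕ< 0<k
      toℕ-switch : toℕ (combine g (join k k (inj₂ i))) ≡ origin g + k
      toℕ-switch = trans (toℕ-at₂ g i)
        (cong (origin g +_) (trans (cong (k +_) (Fin.toℕ-fromℕ< 0<k)) (+-identityʳ k)))

    -- The window stays in its gadget. With the switch on, all cells except the set bits carry `K`,
    -- so only set bits from `i` on can lower the minimum.
    ≤windowMin-gadget : ∀ i v → switch y (r , b) ≡ suc zero → i < k → v ≤ K →
      (∀ i′ → i ≤ toℕ i′ → bits x g i′ ≡ suc zero → v ≤ suc (toℕ i′)) →
      v ≤ windowMin K (input x y) (origin g + i)
    ≤windowMin-gadget i v set i<k v≤K h = ≤windowMin K (input x y) _ v v≤K bound
      where
      bound : ∀ j → origin g + i ≤ toℕ j → toℕ j < origin g + i + K → v ≤ toℕ (input x y j)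
      bound j lo hi with position j
      ... | at r′ b′ o with refl , refl ← Fin.combine-injective r b r′ b′ (window-gadget g (combine r′ b′) o i i<k lo hi) =
        subst (λ c → v ≤ toℕ c) (sym (input-at x y r b o)) (in-cell o lo)
        where
        in-cell : ∀ o → origin g + i ≤ toℕ (combine g (join k k o)) →
          v ≤ toℕ (cell (bits x g) (switch y (r , b)) o)
        in-cell (inj₁ i′) lo with bits x g i′ in eq
        ... | zero     = subst (v ≤_) (sym (Fin.toℕ-fromℕ K)) v≤K
        ... | suc zero = subst (v ≤_) (sym (Fin.toℕ-inject₁ (suc i′)))
                (h i′ (+-cancelˡ-≤ (origin g) _ _ (subst (origin g + i ≤_) (toℕ-at₁ g i′) lo)) eq)
        in-cell (inj₂ _) _ rewrite set = subst (v ≤_) (sym (Fin.toℕ-fromℕ K)) v≤K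

  -- A set bit `i` contributes `i + 1`. If it is clear and the switch is on, the later set bits
  -- contribute at least `i + 2` and all other cells `K`.
  windowMin-differ : ∀ x x′ y y′ (r : Fin p) (b : Fin H) i → bits x (combine r b) i ≡ suc zero → bits x′ (combine r b) i ≡ zero →
    switch y′ (r , b) ≡ suc zero →
    windowMin K (input x y) (origin (combine r b) + toℕ i) ≢ windowMin K (input x′ y′) (origin (combine r b) + toℕ i)
  windowMin-differ x x′ y y′ r b i set clear on eq = contradiction
    (subst (suc (suc (toℕ i)) ≤_) (sym eq)
      (≤windowMin-gadget x′ y′ r b (toℕ i) (suc (suc (toℕ i))) on (Fin.toℕ<n i) (s≤s (Fin.toℕ<n i)) later))
    (<⇒≱ (s≤s (windowMin-set x y r b i set)))
    where
    later : ∀ i′ → toℕ i ≤ toℕ i′ → bits x′ (combine r b) i′ ≡ suc zero → suc (suc (toℕ i)) ≤ suc (toℕ i′)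
    later i′ i≤i′ set′ = s≤s (≤∧≢⇒< i≤i′ λ i≡i′ →
      contradiction (trans (sym set′) (trans (cong (bits x′ (combine r b)) (sym (Fin.toℕ-injective i≡i′))) clear)) λ ())

  cell-bit : ∀ (f : Fin k → Fin 2) c c′ i → cell f c (inj₁ i) ≡ cell f c′ (inj₁ i)
  cell-bit f c c′ i with f i
  ... | zero     = refl
  ... | suc zero = refl

  cell-switch : ∀ (f f′ : Fin k → Fin 2) c i → cell f c (inj₂ i) ≡ cell f′ c (inj₂ i)
  cell-switch f f′ zero       i = refl
  cell-switch f f′ (suc zero) i = refl

  -- Switches show only in second halves. One that starts before the middle of gadget `(r , b)`
  -- belongs to an earlier gadget, in another group or with `b′` below `b`.
  input-agree-before : ∀ x {y y′} r b → (∀ r′ → r′ ≢ r → y r′ ≡ y′ r′) →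
    (∀ b′ → toℕ b′ < toℕ b → switch y (r , b′) ≡ switch y′ (r , b′)) →
    ∀ j → toℕ j < origin (combine r b) + k → input x y j ≡ input x y′ j
  input-agree-before x {y} {y′} r b other earlier j j<mid with position j
  ... | at r′ b′ o = trans (input-at x y r′ b′ o) (trans (agree o j<mid) (sym (input-at x y′ r′ b′ o)))
    where
    g′ = combine r′ b′
    same-switch : origin g′ < origin (combine r b) → switch y (r′ , b′) ≡ switch y′ (r′ , b′)
    same-switch lt with r′ Fin.≟ r
    ... | no  r′≢r = cong (λ a → finToFun {2} {H} a b′) (other r′ r′≢r)
    ... | yes refl = earlier b′ (+-cancelˡ-< (H * toℕ r) _ _
            (subst₂ _<_ (Fin.toℕ-combine r b′) (Fin.toℕ-combine r b) (*-cancelˡ-< w _ _ lt)))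
    agree : ∀ o → toℕ (combine g′ (join k k o)) < origin (combine r b) + k →
      cell (bits x g′) (switch y (r′ , b′)) o ≡ cell (bits x g′) (switch y′ (r′ , b′)) o
    agree (inj₁ i) _  = cell-bit (bits x g′) (switch y (r′ , b′)) (switch y′ (r′ , b′)) i
    agree (inj₂ i) lt = cong (λ c → cell (bits x g′) c (inj₂ i)) (same-switch
      (+-cancelʳ-< k _ _ (≤-<-trans
        (≤-trans (+-monoʳ-≤ (origin g′) (m≤m+n k (toℕ i))) (≤-reflexive (sym (toℕ-at₂ g′ i)))) lt)))

  -- The bit cells of `g`, where alone the inputs may differ, all lie before its middle.
  input-agree-after : ∀ {x x′ y y′} g → y ≗ y′ → (∀ g′ → g′ ≢ g → x g′ ≡ x′ g′) →
    ∀ j → origin g + k ≤ toℕ j → input x y j ≡ input x′ y′ j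
  input-agree-after {x} {x′} {y} {y′} g y≗y′ other j mid≤j with position j
  ... | at r b o = trans (input-at x y r b o) (trans (agree o mid≤j) (sym (input-at x′ y′ r b o)))
    where
    g′ = combine r b
    agree : ∀ o → origin g + k ≤ toℕ (combine g′ (join k k o)) →
      cell (bits x g′) (switch y (r , b)) o ≡ cell (bits x′ g′) (switch y′ (r , b)) o
    agree (inj₂ i) _ = trans (cell-switch (bits x g′) (bits x′ g′) (switch y (r , b)) i)
      (cong (λ a → cell (bits x′ g′) (finToFun {2} {H} a b) (inj₂ i)) (y≗y′ r))
    agree (inj₁ i) le with g′ Fin.≟ g
    ... | no  g′≢g = trans (cell-bit (bits x g′) (switch y (r , b)) (switch y′ (r , b)) i)
      (cong (λ a → cell (finToFun a) (switch y′ (r , b)) (inj₁ i)) (other g′ g′≢g))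
    ... | yes eq   = contradiction
            (+-cancelˡ-≤ (origin g) _ _ (subst (origin g + k ≤_)
              (trans (toℕ-at₁ g′ i) (cong (λ g → origin g + toℕ i) eq)) le))
            (<⇒≱ (Fin.toℕ<n i))

-- Cutting a run inside a pass

module Run {p N R M : ℕ} (alg : Algorithm p N R M) where
  open Algorithm alg

  pass-step : Input N R → Fin p → Fin N → Fin (2 ^ M) → Fin (2 ^ M) × List ℕ
  pass-step A r j s = step r j s (A j)

  -- The outputs of the stages are kept apart, so that one of them can be compared between two
  -- inputs while only the lengths of the preceding ones agree.
  entering : Input N R → ℕ → Fin (2 ^ M) × List ℕ
  entering A t = before p (scan alg A) t init

  midway : Input N R → Fin p → ℕ → Fin (2 ^ M) × List ℕ
  midway A r t = before N (pass-step A r) t (proj₁ (entering A (toℕ r)))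

  remaining : Input N R → Fin p → ℕ → Fin (2 ^ M) × List ℕ
  remaining A r t = after N (pass-step A r) t (proj₁ (midway A r t))

  written : Input N R → ℕ → ℕ
  written A t = length (proj₂ (entering A t))

  entering-suc : ∀ A r t → proj₂ (entering A (suc (toℕ r))) ≡
    proj₂ (entering A (toℕ r)) ++ proj₂ (midway A r t) ++ proj₂ (remaining A r t)
  entering-suc A r t = begin
    proj₂ (entering A (suc (toℕ r)))
      ≡⟨ cong proj₂ (before-suc p (scan alg A) r init) ⟩
    proj₂ (entering A (toℕ r)) ++ proj₂ (scan alg A r (proj₁ (entering A (toℕ r))))
      ≡⟨ cong (λ z → proj₂ (entering A (toℕ r)) ++ proj₂ z)
           (execute-split N (pass-step A r) t (proj₁ (entering A (toℕ r)))) ⟩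
    proj₂ (entering A (toℕ r)) ++ proj₂ (midway A r t) ++ proj₂ (remaining A r t) ∎
    where open ≡-Reasoning

  written-suc : ∀ A r t → written A (suc (toℕ r)) ≡
    written A (toℕ r) + (length (proj₂ (midway A r t)) + length (proj₂ (remaining A r t)))
  written-suc A r t = begin
    written A (suc (toℕ r))
      ≡⟨ cong length (entering-suc A r t) ⟩
    length (proj₂ (entering A (toℕ r)) ++ proj₂ (midway A r t) ++ proj₂ (remaining A r t))
      ≡⟨ length-++ (proj₂ (entering A (toℕ r))) ⟩
    written A (toℕ r) + length (proj₂ (midway A r t) ++ proj₂ (remaining A r t))
      ≡⟨ cong (written A (toℕ r) +_) (length-++ (proj₂ (midway A r t))) ⟩
    written A (toℕ r) + (length (proj₂ (midway A r t)) + length (proj₂ (remaining A r t))) ∎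
    where open ≡-Reasoning

  output-split : ∀ A r t → ∃[ rest ]
    proj₂ (entering A (toℕ r)) ++ proj₂ (midway A r t) ++ proj₂ (remaining A r t) ++ rest ≡ output alg A
  output-split A r t = rest , (begin
    E ++ Mid ++ Rem ++ rest      ≡⟨ cong (E ++_) (++-assoc Mid Rem rest) ⟨
    E ++ (Mid ++ Rem) ++ rest    ≡⟨ ++-assoc E (Mid ++ Rem) rest ⟨
    (E ++ Mid ++ Rem) ++ rest    ≡⟨ cong (_++ rest) (entering-suc A r t) ⟨
    proj₂ (entering A (suc (toℕ r))) ++ rest
      ≡⟨ cong proj₂ (execute-split p (scan alg A) (suc (toℕ r)) init) ⟨
    output alg A                 ∎)
    where
    open ≡-Reasoning
    E    = proj₂ (entering A (toℕ r))
    Mid  = proj₂ (midway A r t)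
    Rem  = proj₂ (remaining A r t)
    rest = proj₂ (after p (scan alg A) (suc (toℕ r)) (proj₁ (entering A (suc (toℕ r)))))

-- The two pigeonhole arguments

module LowerBound (p H k M : ℕ) (alg : Algorithm (suc p) (Gadgets.N (suc p) H k) (suc k) M)
  (solves : SolvesInSingleOutputPass (suc k) alg)
  (K≤N : suc k ≤ Gadgets.N (suc p) H k) (0<k : 0 < k)
  -- Both conditions have the form required by `cube-pigeonhole`: directions times colours stay
  -- below the values of a coordinate. The factor `suc N` counts output lengths.
  (M-small-for-H : suc p * (2 ^ M * suc (Gadgets.N (suc p) H k)) < 2 ^ H)
  (M-small-for-k : suc p * H * ((2 ^ H) ^ suc p * (2 ^ M * suc (Gadgets.N (suc p) H k))) < 2 ^ k)
  where

  open Gadgets (suc p) H k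
  open Run alg

  answers : ∀ A r t → ∃[ rest ]
    proj₂ (entering A (toℕ r)) ++ proj₂ (midway A r t) ++ proj₂ (remaining A r t) ++ rest
      ≡ applyUpTo (windowMin K A) (N ∸ k)
  answers A r t with rest , eq ← output-split A r t =
    rest , trans eq (trans (solves A) (slidingMin≡applyUpTo K A K≤N))

  -- Equal counts at the start of pass `r` put the common midway output at the same offset, even if
  -- the earlier answers differ.
  same-answer-midway : ∀ A A′ r t i → midway A r t ≡ midway A′ r t →
    written A (toℕ r) ≡ written A′ (toℕ r) → written A (toℕ r) ≤ i →
    i < written A (toℕ r) + length (proj₂ (midway A r t)) → windowMin K A i ≡ windowMin K A′ i
  same-answer-midway A A′ r t i same = common-segment (windowMin K A) (windowMin K A′) (N ∸ k) (N ∸ k)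
    (proj₂ (entering A (toℕ r))) (proj₂ (entering A′ (toℕ r))) (proj₂ (midway A r t))
    (proj₂ (answers A r t))
    (trans (cong (λ out → proj₂ (entering A′ (toℕ r)) ++ proj₂ out ++ proj₂ (remaining A′ r t) ++ proj₁ (answers A′ r t)) same)
      (proj₂ (answers A′ r t)))

  -- No answer of group `r` is written before pass `r`, and all but those of its last `k` starting
  -- positions are written by its end. The subtraction fits the last group, as there are only
  -- `N ∸ k` windows.
  group-in-pass : ∀ A → ∃[ r ] written A (toℕ r) ≤ w * (H * toℕ r)
    × w * (H * suc (toℕ r)) ∸ k ≤ written A (suc (toℕ r))
  group-in-pass A = crossing (written A) (λ r → w * (H * r)) (λ r → w * (H * r) ∸ k)
    z≤n (λ r → m∸n≤m _ k) p (≤-reflexive (begin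
      w * (H * suc p) ∸ k  ≡⟨ cong (_∸ k) end≡N ⟩
      N ∸ k                ≡⟨ length-applyUpTo (windowMin K A) (N ∸ k) ⟨
      length (applyUpTo (windowMin K A) (N ∸ k))
        ≡⟨ cong length (trans (solves A) (slidingMin≡applyUpTo K A K≤N)) ⟨
      length (output alg A)
        ≡⟨ cong (length ∘ proj₂) (before-all (suc p) (scan alg A) (Algorithm.init alg)) ⟨
      written A (suc p)    ∎))
    where open ≡-Reasoning

  -- The last window of group r that is used starts k + 1 positions before the
  -- group ends, whence the left side of done.
  record Unread (x : Fin (suc p * H) → Fin (2 ^ k)) : Set where
    field
      r : Fin (suc p)
      b : Fin H
      y : Fin (suc p) → Fin (2 ^ H)
    g : Fin (suc p * H)
    g = combine r b
    A : Input N K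
    A = input x y
    mid : ℕ
    mid = origin g + k
    field
      on     : switch y (r , b) ≡ suc zero
      unread : written A (toℕ r) + length (proj₂ (midway A r mid)) ≤ origin g
      done   : w * (H * suc (toℕ r)) ∸ k ≤ written A (suc (toℕ r))

  module _ (x : Fin (suc p * H) → Fin (2 ^ k)) where

    -- In pass `r` the two runs coincide up to the switch of `(r , b)`. An answer for the gadget's
    -- origin written by then under `y′` would also be the answer under `y`, but it is positive with
    -- the switch on and 0 with it off.
    unread-by-difference : ∀ {y y′} r b →
      (∀ r′ → r′ ≢ r → y r′ ≡ y′ r′) → (∀ b′ → toℕ b′ < toℕ b → switch y (r , b′) ≡ switch y′ (r , b′)) →
      switch y (r , b) ≡ zero → switch y′ (r , b) ≡ suc zero →
      proj₁ (entering (input x y) (toℕ r)) ≡ proj₁ (entering (input x y′) (toℕ r)) →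
      written (input x y) (toℕ r) ≡ written (input x y′) (toℕ r) →
      written (input x y) (toℕ r) ≤ w * (H * toℕ r) →
      w * (H * suc (toℕ r)) ∸ k ≤ written (input x y′) (suc (toℕ r)) → Unread x
    unread-by-difference {y} {y′} r b other earlier off on s≡s′ c≡c′ c≤ done =
      record { r = r ; b = b ; y = y′ ; on = on ; done = done ; unread = ≮⇒≥ not-read }
      where
      A A′ : Input N K
      A  = input x y
      A′ = input x y′
      g : Fin (suc p * H)
      g = combine r b
      mid : ℕ
      mid = origin g + k
      same-mid : midway A r mid ≡ midway A′ r mid
      same-mid = trans
        (before-cong N mid (proj₁ (entering A (toℕ r)))
          (λ i i<mid s → cong (Algorithm.step alg r i s) (input-agree-before x r b other earlier i i<mid)))
        (cong (before N (pass-step A′ r) mid) s≡s′)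
      not-read : ¬ (origin g < written A′ (toℕ r) + length (proj₂ (midway A′ r mid)))
      not-read g< = contradiction
        (begin
          1                               ≤⟨ ≤windowMin-gadget x y′ r b 0 1 on 0<k (s≤s z≤n) (λ _ _ _ → s≤s z≤n) ⟩
          windowMin K A′ (origin g + 0)   ≡⟨ cong (windowMin K A′) (+-identityʳ (origin g)) ⟩
          windowMin K A′ (origin g)       ≡⟨ same-answer-midway A′ A r mid (origin g) (sym same-mid) (sym c≡c′)
                                               (subst (_≤ origin g) c≡c′ (≤-trans c≤ (group-origin≤ r b))) g< ⟩
          windowMin K A (origin g)        ≤⟨ windowMin-zero x y r b 0<k off ⟩
          0                               ∎)
        λ ()
        where open ≤-Reasoning

    pass : (Fin (suc p) → Fin (2 ^ H)) → Fin (suc p)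
    pass y = proj₁ (group-in-pass (input x y))

    written<1+N : ∀ y → written (input x y) (toℕ (pass y)) < suc N
    written<1+N y = s≤s (≤-trans (proj₁ (proj₂ (group-in-pass (input x y))))
      (subst (w * (H * toℕ (pass y)) ≤_) end≡N (*-monoʳ-≤ w (*-monoʳ-≤ H (<⇒≤ (Fin.toℕ<n (pass y)))))))

    -- The direction is the group whose answers are written in the pass of the same number, so the
    -- settings found differ in its switches only.
    entry-colour : (Fin (suc p) → Fin (2 ^ H)) → Fin (suc p) × Fin (2 ^ M * suc N)
    entry-colour y =
      pass y , combine (proj₁ (entering (input x y) (toℕ (pass y)))) (fromℕ< (written<1+N y))

    -- At the first switch in which they differ, whichever setting turns it on becomes the `y` of
    -- `Unread`; hence `done` is required for both.
    unread-same-entry : ∀ y y′ r →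
      y r ≢ y′ r → (∀ r′ → r′ ≢ r → y r′ ≡ y′ r′) →
      proj₁ (entering (input x y) (toℕ r)) ≡ proj₁ (entering (input x y′) (toℕ r)) →
      written (input x y) (toℕ r) ≡ written (input x y′) (toℕ r) →
      written (input x y) (toℕ r) ≤ w * (H * toℕ r) →
      w * (H * suc (toℕ r)) ∸ k ≤ written (input x y) (suc (toℕ r)) →
      w * (H * suc (toℕ r)) ∸ k ≤ written (input x y′) (suc (toℕ r)) → Unread x
    unread-same-entry y y′ r differ other s≡s′ c≡c′ c≤ done done′ =
      let b , differ-b , earlier = first-difference (finToFun (y r)) (finToFun (y′ r))
                                     (differ ∘ finToFun-injective {2} {H} (y r) (y′ r))
      in  [ (λ (off , on) → unread-by-difference r b other earlier off on s≡s′ c≡c′ c≤ done′)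
          , (λ (off , on) → unread-by-difference r b (λ r′ → sym ∘ other r′) (λ b′ → sym ∘ earlier b′)
              off on (sym s≡s′) (sym c≡c′) (subst (_≤ w * (H * toℕ r)) c≡c′ c≤) done)
          ]′ (distinct-bits (switch y (r , b)) (switch y′ (r , b)) differ-b)

    unread-same-colour : ∀ y y′ → entry-colour y ≡ entry-colour y′ →
      y (pass y) ≢ y′ (pass y) → (∀ r → r ≢ pass y → y r ≡ y′ r) → Unread x
    unread-same-colour y y′ same-colour differ other =
      unread-same-entry y y′ r differ other
        (trans (proj₁ same-entry) (cong (λ r → proj₁ (entering (input x y′) (toℕ r))) (sym r≡r′)))
        (trans same-written (cong (λ r → written (input x y′) (toℕ r)) (sym r≡r′)))
        (proj₁ (proj₂ (group-in-pass (input x y))))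
        (proj₂ (proj₂ (group-in-pass (input x y))))
        (subst (λ r → w * (H * suc (toℕ r)) ∸ k ≤ written (input x y′) (suc (toℕ r)))
          (sym r≡r′) (proj₂ (proj₂ (group-in-pass (input x y′)))))
      where
      r r′ : Fin (suc p)
      r  = pass y
      r′ = pass y′
      r≡r′ : r ≡ r′
      r≡r′ = cong proj₁ same-colour
      same-entry = Fin.combine-injective
        (proj₁ (entering (input x y) (toℕ r))) (fromℕ< (written<1+N y))
        (proj₁ (entering (input x y′) (toℕ r′))) (fromℕ< (written<1+N y′)) (cong proj₂ same-colour)
      same-written : written (input x y) (toℕ r) ≡ written (input x y′) (toℕ r′)
      same-written = Fin.fromℕ<-injective _ _ (written<1+N y) (written<1+N y′) (proj₂ same-entry)

    unread-input : Unread x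
    unread-input =
      let y , y′ , same-colour , differ , other =
            cube-pigeonhole (suc p) (2 ^ H) (2 ^ M * suc N) M-small-for-H entry-colour
      in  unread-same-colour y y′ same-colour differ other

  module _ {x} (u : Unread x) where
    open Unread u

    mid-state : Fin (2 ^ M)
    mid-state = proj₁ (midway A r mid)

    mid-output : List ℕ
    mid-output = proj₂ (entering A (toℕ r)) ++ proj₂ (midway A r mid)

    length-mid-output : length mid-output ≡ written A (toℕ r) + length (proj₂ (midway A r mid))
    length-mid-output = length-++ (proj₂ (entering A (toℕ r)))

    mid-output≤origin : length mid-output ≤ origin g
    mid-output≤origin = ≤-trans (≤-reflexive length-mid-output) unread

    mid-output<1+N : length mid-output < suc N
    mid-output<1+N = s≤s (≤-trans mid-output≤origin (origin≤N g))

    answers-after-mid : ∃[ rest ] mid-output ++ proj₂ (remaining A r mid) ++ rest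
      ≡ applyUpTo (windowMin K A) (N ∸ k)
    answers-after-mid = proj₁ (answers A r mid) ,
      trans (++-assoc (proj₂ (entering A (toℕ r))) (proj₂ (midway A r mid)) _) (proj₂ (answers A r mid))

    -- As `k` switch cells follow the bit cells, the bit windows avoid the last `k` starting
    -- positions of the group, which `done` leaves open.
    gadget-done : ∀ i → i < k → origin g + i < length mid-output + length (proj₂ (remaining A r mid))
    gadget-done i i<k = begin
      suc (origin g + i)                     ≤⟨ m+n≤o⇒m≤o∸n _ room ⟩
      w * (H * suc (toℕ r)) ∸ k              ≤⟨ done ⟩
      written A (suc (toℕ r))                ≡⟨ written-suc A r mid ⟩
      written A (toℕ r) + (length (proj₂ (midway A r mid)) + length (proj₂ (remaining A r mid)))
                                             ≡⟨ +-assoc (written A (toℕ r)) _ _ ⟨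
      written A (toℕ r) + length (proj₂ (midway A r mid)) + length (proj₂ (remaining A r mid))
                                             ≡⟨ cong (_+ length (proj₂ (remaining A r mid))) length-mid-output ⟨
      length mid-output + length (proj₂ (remaining A r mid)) ∎
      where
      open ≤-Reasoning
      room : suc (origin g + i) + k ≤ w * (H * suc (toℕ r))
      room = begin
        suc (origin g + i) + k   ≡⟨ cong (_+ k) (+-suc (origin g) i) ⟨
        origin g + suc i + k     ≤⟨ +-monoˡ-≤ k (+-monoʳ-≤ (origin g) i<k) ⟩
        origin g + k + k         ≡⟨ +-assoc (origin g) k k ⟩
        origin g + w             ≤⟨ ≤group-end r b ⟩
        w * (H * suc (toℕ r))    ∎

  -- From the middle of the gadget on, the inputs and states agree, so pass `r` ends with the same
  -- output at the same offset. It covers the bit windows by `unread` and `done`.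
  windowMin-same : ∀ {x x′} (u : Unread x) (u′ : Unread x′) →
    let open Unread u using (r; b; y; g; A) in
    r ≡ Unread.r u′ → b ≡ Unread.b u′ → y ≗ Unread.y u′ → (∀ g′ → g′ ≢ g → x g′ ≡ x′ g′) →
    mid-state u ≡ mid-state u′ → length (mid-output u) ≡ length (mid-output u′) →
    ∀ (i : Fin k) → windowMin K A (origin g + toℕ i) ≡ windowMin K (Unread.A u′) (origin g + toℕ i)
  windowMin-same u@(record { r = r ; b = b }) u′ refl refl y≗y′ other s≡s′ c≡c′ i =
    common-segment (windowMin K A) (windowMin K A′) (N ∸ k) (N ∸ k) (mid-output u) (mid-output u′)
      (proj₂ (remaining A r mid)) (proj₂ (answers-after-mid u))
      (trans (cong (λ out → mid-output u′ ++ proj₂ out ++ proj₁ (answers-after-mid u′)) same-remaining)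
        (proj₂ (answers-after-mid u′)))
      c≡c′ (≤-trans (mid-output≤origin u) (m≤m+n _ (toℕ i))) (gadget-done u (toℕ i) (Fin.toℕ<n i))
    where
    open Unread u using (A; g; mid)
    open Unread u′ using () renaming (A to A′)
    same-remaining : remaining A r mid ≡ remaining A′ r mid
    same-remaining = trans
      (after-cong N mid (mid-state u)
        (λ i mid≤i s → cong (Algorithm.step alg r i s) (input-agree-after g y≗y′ other i mid≤i)))
      (cong (after N (pass-step A′ r) mid) s≡s′)

  -- Some bit of the gadget is set in one input and clear in the other. The switch is on in both, so
  -- `windowMin-differ` applies either way.
  same-mid-impossible : ∀ {x x′} (u : Unread x) (u′ : Unread x′) →
    let open Unread u using (r; b; y; g) in
    r ≡ Unread.r u′ → b ≡ Unread.b u′ → y ≗ Unread.y u′ → x g ≢ x′ g → (∀ g′ → g′ ≢ g → x g′ ≡ x′ g′) →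
    mid-state u ≡ mid-state u′ → length (mid-output u) ≡ length (mid-output u′) → ⊥
  same-mid-impossible {x} {x′} u u′ refl refl y≗y′ differ other s≡s′ c≡c′ =
    let i , differ-i , _ = first-difference (bits x (Unread.g u)) (bits x′ (Unread.g u))
                             (differ ∘ finToFun-injective {2} {k} (x (Unread.g u)) (x′ (Unread.g u)))
        same = windowMin-same u u′ refl refl y≗y′ other s≡s′ c≡c′ i
    in  [ (λ (clear , set) → windowMin-differ x′ x (Unread.y u′) (Unread.y u) (Unread.r u) (Unread.b u) i set clear (Unread.on u) (sym same))
        , (λ (clear , set) → windowMin-differ x x′ (Unread.y u) (Unread.y u′) (Unread.r u) (Unread.b u) i set clear (Unread.on u′) same)
        ]′ (distinct-bits (bits x (Unread.g u) i) (bits x′ (Unread.g u) i) differ-i)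

  -- The `y` found for `x` may vary with `x`, so it is made part of the colour.
  mid-colour : (Fin (suc p * H) → Fin (2 ^ k)) → Fin (suc p * H) × Fin ((2 ^ H) ^ suc p * (2 ^ M * suc N))
  mid-colour x = let u = unread-input x in
    Unread.g u , combine (funToFin (Unread.y u)) (combine (mid-state u) (fromℕ< (mid-output<1+N u)))

  mid-colour-injective-on-lines : ∀ x x′ → mid-colour x ≡ mid-colour x′ →
    let g = proj₁ (mid-colour x) in x g ≢ x′ g → (∀ g′ → g′ ≢ g → x g′ ≡ x′ g′) → ⊥
  mid-colour-injective-on-lines x x′ same-colour differ other =
    same-mid-impossible u u′ (proj₁ same-gadget) (proj₂ same-gadget) same-y differ other
      (proj₁ same-mid) (Fin.fromℕ<-injective _ _ (mid-output<1+N u) (mid-output<1+N u′) (proj₂ same-mid))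
    where
    u = unread-input x
    u′ = unread-input x′
    open Unread u using (r; b; y)
    open Unread u′ using () renaming (r to r′; b to b′; y to y′)
    same-gadget = Fin.combine-injective r b r′ b′ (cong proj₁ same-colour)
    same-code = Fin.combine-injective
      (funToFin y) (combine (mid-state u) (fromℕ< (mid-output<1+N u)))
      (funToFin y′) (combine (mid-state u′) (fromℕ< (mid-output<1+N u′))) (cong proj₂ same-colour)
    same-mid = Fin.combine-injective
      (mid-state u) (fromℕ< (mid-output<1+N u))
      (mid-state u′) (fromℕ< (mid-output<1+N u′)) (proj₂ same-code)
    same-y : y ≗ y′
    same-y i = begin
      y i                                   ≡⟨ Fin.finToFun-funToFin y i ⟨
      finToFun {n = suc p} (funToFin y) i   ≡⟨ cong (λ c → finToFun {n = suc p} c i) (proj₁ same-code) ⟩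
      finToFun {n = suc p} (funToFin y′) i  ≡⟨ Fin.finToFun-funToFin y′ i ⟩
      y′ i                                  ∎
      where open ≡-Reasoning

  impossible : ⊥
  impossible =
    let x , x′ , same-colour , differ , other =
          cube-pigeonhole (suc p * H) (2 ^ k) _ M-small-for-k mid-colour
    in  mid-colour-injective-on-lines x x′ same-colour differ other

-- Choice of parameters

n<2^n : ∀ n → n < 2 ^ n
n<2^n zero    = s≤s z≤n
n<2^n (suc n) = begin-strict
  suc n              ≤⟨ n<2^n n ⟩
  2 ^ n              <⟨ m<m+n (2 ^ n) (m^n>0 2 n) ⟩
  2 ^ n + 2 ^ n      ≡⟨ cong (2 ^ n +_) (+-identityʳ (2 ^ n)) ⟨
  2 ^ suc n          ∎
  where open ≤-Reasoning

space≤maxSpace : ∀ space {N k} → k < N → space N (suc k) ≤ maxSpace space N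
space≤maxSpace space {N} k<N =
  v≤max⁺ 0 _ (inj₂ (Any.map⁺ {f = space N} (Any.applyUpTo⁺ suc ≤-refl k<N)))

-- Turns the space bound at `N = c * (h * h)` into at most `h` bits.
square-cancel : ∀ c h f → 0 < c → (c * f) ^ 2 ≤ c * (h * h) → f ≤ h
square-cancel c@(suc _) h f _ cf²≤ = ≮⇒≥ λ h<f → <⇒≱ (too-large h<f) cf²≤
  where
  open ≤-Reasoning
  too-large : h < f → c * (h * h) < (c * f) ^ 2
  too-large h<f = begin-strict
    c * (h * h)      <⟨ *-monoʳ-< c (*-mono-< h<f h<f) ⟩
    c * (f * f)      ≤⟨ m≤n*m (c * (f * f)) c ⟩
    c * (c * (f * f)) ≡⟨ solve 2 (λ c f → c :* (c :* (f :* f)) := (c :* f) :* ((c :* f) :* con 1)) refl c f ⟩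
    (c * f) ^ 2      ∎

module Parameters (P h : ℕ) {{_ : NonZero P}} {{_ : NonZero h}} (c≤h : 120 * (P * P) ≤ h) where

  c H k N : ℕ
  -- There are `5 * (P * h)` gadgets of width `24 * (P * h)`, whence the factor 120 and
  -- `N = c * (h * h)`.
  c = 120 * (P * P)
  H = 5 * h
  k = 12 * (P * h)
  N = P * H * (k + k)

  private instance
    PP≢0 : NonZero (P * P)
    PP≢0 = m*n≢0 P P
    c≢0 : NonZero c
    c≢0 = m*n≢0 120 (P * P)
    k≢0 : NonZero k
    k≢0 = m*n≢0 12 (P * h) {{it}} {{m*n≢0 P h}}
    k+k≢0 : NonZero (k + k)
    k+k≢0 = >-nonZero (<-≤-trans (>-nonZero⁻¹ k) (m≤m+n k k))
    PH≢0 : NonZero (P * H)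
    PH≢0 = m*n≢0 P H {{it}} {{m*n≢0 5 h}}

  0<k : 0 < k
  0<k = >-nonZero⁻¹ k

  0<c : 0 < c
  0<c = >-nonZero⁻¹ c

  N≡ch² : N ≡ c * (h * h)
  N≡ch² = solve 2 (λ P h → (P :* (con 5 :* h)) :* (con 12 :* (P :* h) :+ con 12 :* (P :* h))
                       := (con 120 :* (P :* P)) :* (h :* h)) refl P h

  h≤N : h ≤ N
  h≤N = ≤-trans (m≤m*n h h) (≤-trans (m≤n*m (h * h) c) (≤-reflexive (sym N≡ch²)))

  k<N : k < N
  k<N = <-≤-trans (m<m+n k 0<k) (m≤n*m (k + k) (P * H))

  P≤h : P ≤ h
  P≤h = ≤-trans (m≤m*n P P) (≤-trans (m≤n*m (P * P) 120) c≤h)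

  -- Since `c ≤ h`, `N` is at most the cube of `h`.
  N<2^3h : N < 2 ^ (3 * h)
  N<2^3h = begin-strict
    N                        ≡⟨ N≡ch² ⟩
    c * (h * h)              ≤⟨ *-monoˡ-≤ (h * h) c≤h ⟩
    h * (h * h)              <⟨ *-mono-< (n<2^n h) (*-mono-< (n<2^n h) (n<2^n h)) ⟩
    2 ^ h * (2 ^ h * 2 ^ h)  ≡⟨ solve 1 (λ x → x :* (x :* x) := x :* (x :* (x :* con 1))) refl (2 ^ h) ⟩
    (2 ^ h) ^ 3              ≡⟨ ^-*-assoc 2 h 3 ⟩
    2 ^ (h * 3)              ≡⟨ cong (2 ^_) (*-comm h 3) ⟩
    2 ^ (3 * h)              ∎
    where open ≤-Reasoning

  module _ {M} (M≤h : M ≤ h) where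
    open ≤-Reasoning

    configurations≤ : 2 ^ M * suc N ≤ 2 ^ (h + 3 * h)
    configurations≤ = begin
      2 ^ M * suc N          ≤⟨ *-mono-≤ (^-monoʳ-≤ 2 M≤h) N<2^3h ⟩
      2 ^ h * 2 ^ (3 * h)    ≡⟨ ^-distribˡ-+-* 2 h (3 * h) ⟨
      2 ^ (h + 3 * h)        ∎

    -- The exponent `5 * h` allots `h` to the pass, `h` to the state and `3 * h` to the output
    -- length.
    M-small-for-H : P * (2 ^ M * suc N) < 2 ^ H
    M-small-for-H = begin-strict
      P * (2 ^ M * suc N)      ≤⟨ *-mono-≤ P≤h configurations≤ ⟩
      h * 2 ^ (h + 3 * h)      <⟨ *-monoˡ-< (2 ^ (h + 3 * h)) {{m^n≢0 2 (h + 3 * h)}} (n<2^n h) ⟩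
      2 ^ h * 2 ^ (h + 3 * h)  ≡⟨ ^-distribˡ-+-* 2 h (h + 3 * h) ⟨
      2 ^ (h + (h + 3 * h))    ≡⟨ cong (2 ^_) (solve 1 (λ h → h :+ (h :+ con 3 :* h) := con 5 :* h) refl h) ⟩
      2 ^ H                    ∎

    -- The gadget takes `3 * h`, the state and length `4 * h`, together at most `7 * (P * h)`; the
    -- choice of `y` takes the other `5 * (P * h)`.
    M-small-for-k : P * H * ((2 ^ H) ^ P * (2 ^ M * suc N)) < 2 ^ k
    M-small-for-k = begin-strict
      P * H * ((2 ^ H) ^ P * (2 ^ M * suc N))
        ≤⟨ *-mono-≤ (m≤m*n (P * H) (k + k)) (*-monoʳ-≤ ((2 ^ H) ^ P) configurations≤) ⟩
      N * ((2 ^ H) ^ P * 2 ^ (h + 3 * h))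
        ≡⟨ cong (λ z → N * (z * 2 ^ (h + 3 * h))) (^-*-assoc 2 H P) ⟩
      N * (2 ^ (H * P) * 2 ^ (h + 3 * h))
        ≡⟨ cong (N *_) (^-distribˡ-+-* 2 (H * P) (h + 3 * h)) ⟨
      N * 2 ^ (H * P + (h + 3 * h))
        <⟨ *-monoˡ-< (2 ^ (H * P + (h + 3 * h))) {{m^n≢0 2 (H * P + (h + 3 * h))}} N<2^3h ⟩
      2 ^ (3 * h) * 2 ^ (H * P + (h + 3 * h))
        ≡⟨ ^-distribˡ-+-* 2 (3 * h) (H * P + (h + 3 * h)) ⟨
      2 ^ (3 * h + (H * P + (h + 3 * h)))
        ≤⟨ ^-monoʳ-≤ 2 exponent≤ ⟩
      2 ^ k ∎
      where
      exponent≤ : 3 * h + (H * P + (h + 3 * h)) ≤ k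
      exponent≤ = begin
        3 * h + (H * P + (h + 3 * h))
          ≡⟨ solve 2 (λ P h → con 3 :* h :+ ((con 5 :* h) :* P :+ (h :+ con 3 :* h)) := con 5 :* (P :* h) :+ con 7 :* h) refl P h ⟩
        5 * (P * h) + 7 * h
          ≤⟨ +-monoʳ-≤ (5 * (P * h)) (*-monoʳ-≤ 7 (m≤n*m h P)) ⟩
        5 * (P * h) + 7 * (P * h)
          ≡⟨ *-distribʳ-+ (P * h) 5 7 ⟨
        k ∎

-- The contradiction at one length and window size

single-length-impossible : ∀ p h {{_ : NonZero h}} (c≤h : 120 * (suc p * suc p) ≤ h) →
  let open Parameters (suc p) h c≤h in
  ∀ space → (c * maxSpace space N) ^ 2 ≤ N → SolvesAllWindowSizes (suc p) space → ⊥
single-length-impossible p h c≤h space small solvable =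
  LowerBound.impossible p H k (space N (suc k)) (proj₁ solution) (proj₂ solution)
    k<N 0<k (M-small-for-H M≤h) (M-small-for-k M≤h)
  where
  open Parameters (suc p) h c≤h
  solution = solvable N (suc k) (s≤s z≤n) k<N
  M≤h : space N (suc k) ≤ h
  M≤h = ≤-trans (space≤maxSpace space k<N)
    (square-cancel c h (maxSpace space N) 0<c (≤-trans small (≤-reflexive N≡ch²)))

theorem5p4 : (p : ℕ) → 1 ≤ p →
    ¬ (∃[ space ] (IsLittleO√ (maxSpace space) × SolvesAllWindowSizes p space))
theorem5p4 (suc p) _ (space , small , solvable)
  with N₀ , bound ← small (120 * (suc p * suc p)) =
  single-length-impossible p h c≤h space (bound N (≤-trans (m≤n+m N₀ c) h≤N)) solvable
  where
  -- Large enough for `c ≤ h` and, as `h ≤ N`, also for `N₀ ≤ N`.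
  h = 120 * (suc p * suc p) + N₀
  c≤h = m≤m+n (120 * (suc p * suc p)) N₀
  instance
    h≢0 : NonZero h
    h≢0 = >-nonZero (≤-trans (s≤s z≤n) c≤h)
  open Parameters (suc p) h c≤h
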